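{- Let $p$ be a prime number and let $r$ be a natural number. Assume that $(\mathbb{Z}_p)^r$ is not a DCI group. If either of the following is true, then $(\mathbb{Z}_p)^{r+2}$ is not a CI group: (1) $p \neq 3$; or (2) there is a subset $S \subseteq (\mathbb{Z}_p)^r$ with $|S| < p^{r-1}$ such that the Cayley digraph $\overrightarrow{\mathrm{Cay}}\bigl((\mathbb{Z}_p)^r; S\bigr)$ is not a DCI digraph.
   Context: Let $G$ be a finite group. For a subset $S \subseteq G$, the Cayley digraph $\overrightarrow{\mathrm{Cay}}(G;S)$ is the directed graph with vertex set $G$ and with a directed edge $g \to h$ if and only if $h \in Sg$ (loops are allowed, i.e. $S$ may contain the identity). If $S = S^{ -1}$ ($S$ is symmetric), it can be viewed as an undirected graph, called a Cayley graph and denoted $\mathrm{Cay}(G;S)$. A Cayley digraph $\overrightarrow{\mathrm{Cay}}(G;S)$ is a DCI digraph if, for every subset $S'$ of $G$ such that $\overrightarrow{\mathrm{Cay}}(G;S) \cong \overrightarrow{\mathrm{Cay}}(G;S')$, there is a group automorphism $\alpha$ of $G$ with $\alpha(S)=S'$. A Cayley graph $\mathrm{Cay}(G;S)$ is a CI graph if, for every symmetric subset $S'$ of $G$ such that $\mathrm{Cay}(G;S) \cong \mathrm{Cay}(G;S')$, there is a group automorphism $\alpha$ of $G$ with $\alpha(S)=S'$. $G$ is a DCI group if every Cayley digraph of $G$ is a DCI digraph, and $G$ is a CI group if every (undirected) Cayley graph of $G$ is a CI graph. -}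

module Defs where

open import Algebra.Bundles.Raw using (RawGroup)
open import Algebra.Definitions using (Associative; LeftIdentity; RightIdentity; LeftInverse; RightInverse)
open import Algebra.Morphism.Structures using (module GroupMorphisms)
open import Algebra.Structures using (IsGroup)
open import Data.Bool.Base using (Bool; T)
open import Data.Fin.Base using (Fin; toℕ)
open import Data.Fin.Properties using (toℕ<n; toℕ≤n; toℕ-injective; toℕ-fromℕ<; *↔×; 1↔⊤)
open import Data.Fin.Subset using (∣_∣)
open import Data.Nat.Base using (ℕ; zero; suc; _+_; _*_; _∸_; _^_; NonZero)
open import Data.Nat.DivMod using (_%_; _mod_; m%n<n; m<n⇒m%n≡m; m%n%n≡m%n; n%n≡0; %-distribˡ-+)
open import Data.Nat.Properties using (+-assoc; +-comm; m+[n∸m]≡n)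
open import Data.Product.Base using (∃; _×_; _,_; uncurry)
open import Data.Product.Function.NonDependent.Propositional using (_×-↔_)
open import Data.Unit.Base using (tt)
open import Data.Vec.Base using (Vec; []; _∷_; map; replicate; tabulate; zipWith)
open import Data.Vec.Properties using (zipWith-assoc; zipWith-identityˡ; zipWith-identityʳ; zipWith-inverseˡ; zipWith-inverseʳ)
open import Function.Bundles using (_↔_; Inverse; mk↔ₛ′)
open import Function.Construct.Identity using (↔-id)
open import Function.Properties.Inverse using (↔-trans)
open import Level using (0ℓ)
open import Relation.Binary.Core using (Rel)
open import Relation.Binary.Morphism.Structures using (IsOrderIsomorphism)
open import Relation.Binary.PropositionalEquality
open import Relation.Unary using (Pred; _≐_)

record FiniteGroup : Set₁ where
  infixl 7 _∙_
  infix  8 _⁻¹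
  field
    Carrier     : Set
    _∙_         : Carrier → Carrier → Carrier
    ε           : Carrier
    _⁻¹         : Carrier → Carrier
    isGroup     : IsGroup _≡_ _∙_ ε _⁻¹
    order       : ℕ
    enumeration : Fin order ↔ Carrier

  rawGroup : RawGroup 0ℓ 0ℓ
  rawGroup = record { _≈_ = _≡_ ; _∙_ = _∙_ ; ε = ε ; _⁻¹ = _⁻¹ }

record Digraph : Set₁ where
  infix 4 _⟶_
  field
    Vertex : Set
    _⟶_    : Rel Vertex 0ℓ

infix 4 _≅_

-- IsOrderIsomorphism assumes no order axioms: it says that f is bijective
-- and that edges are both preserved and reflected.
_≅_ : Digraph → Digraph → Set
Γ ≅ Δ = ∃ λ (f : Vertex Γ → Vertex Δ) →
  IsOrderIsomorphism _≡_ _≡_ (_⟶_ Γ) (_⟶_ Δ) f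
  where open Digraph

module _ (G : FiniteGroup) where
  open FiniteGroup G

  -- A subset of a finite set is encoded by its characteristic function, so
  -- membership is decidable.
  Subset : Set
  Subset = Carrier → Bool

  Members : Subset → Pred Carrier 0ℓ
  Members S x = T (S x)

  card : Subset → ℕ
  card S = ∣ tabulate (λ i → S (Inverse.to enumeration i)) ∣

  Image : (Carrier → Carrier) → Subset → Pred Carrier 0ℓ
  Image f S y = ∃ λ x → Members S x × y ≡ f x

  Symmetric : Subset → Set
  Symmetric S = Members S ≐ Image _⁻¹ S

  Cay : Subset → Digraph
  Cay S = record
    { Vertex = Carrier
    ; _⟶_    = λ g h → ∃ λ s → Members S s × h ≡ s ∙ g
    }

  IsAutomorphism : (Carrier → Carrier) → Set
  IsAutomorphism = GroupMorphisms.IsGroupIsomorphism rawGroup rawGroup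

  AutomorphismEquivalent : Subset → Subset → Set
  AutomorphismEquivalent S S′ =
    ∃ λ α → IsAutomorphism α × Image α S ≐ Members S′

  IsDCIDigraph : Subset → Set
  IsDCIDigraph S =
    ∀ S′ → Cay S ≅ Cay S′ → AutomorphismEquivalent S S′

  -- Used for symmetric S only.  An undirected graph is a digraph with
  -- symmetric edge relation, so graph isomorphism is digraph isomorphism.
  IsCIGraph : Subset → Set
  IsCIGraph S =
    ∀ S′ → Symmetric S′ → Cay S ≅ Cay S′ → AutomorphismEquivalent S S′

  IsDCIGroup : Set
  IsDCIGroup = ∀ S → IsDCIDigraph S

  IsCIGroup : Set
  IsCIGroup = ∀ S → Symmetric S → IsCIGraph S

module _ (n : ℕ) .{{_ : NonZero n}} where
  open ≡-Reasoning

  infixl 6 _⊕_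
  _⊕_ : Fin n → Fin n → Fin n
  i ⊕ j = (toℕ i + toℕ j) mod n

  ⊖_ : Fin n → Fin n
  ⊖ i = (n ∸ toℕ i) mod n

  𝟘 : Fin n
  𝟘 = 0 mod n

  toℕ-mod : ∀ a → toℕ (a mod n) ≡ a % n
  toℕ-mod a = toℕ-fromℕ< (m%n<n a n)

  mod-toℕ : ∀ i → toℕ i mod n ≡ i
  mod-toℕ i = toℕ-injective (trans (toℕ-mod (toℕ i)) (m<n⇒m%n≡m (toℕ<n i)))

  mod-cong : ∀ {a b} → a % n ≡ b % n → a mod n ≡ b mod n
  mod-cong {a} {b} eq = toℕ-injective (trans (toℕ-mod a) (trans eq (sym (toℕ-mod b))))

  %-absorbˡ : ∀ a b → (a % n + b) % n ≡ (a + b) % n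
  %-absorbˡ a b = begin
    (a % n + b) % n          ≡⟨ %-distribˡ-+ (a % n) b n ⟩
    (a % n % n + b % n) % n  ≡⟨ cong (λ x → (x + b % n) % n) (m%n%n≡m%n a n) ⟩
    (a % n + b % n) % n      ≡⟨ %-distribˡ-+ a b n ⟨
    (a + b) % n              ∎

  mod-⊕ : ∀ a j → (a mod n) ⊕ j ≡ (a + toℕ j) mod n
  mod-⊕ a j = mod-cong (trans (cong (λ x → (x + toℕ j) % n) (toℕ-mod a)) (%-absorbˡ a (toℕ j)))

  ⊕-comm : ∀ i j → i ⊕ j ≡ j ⊕ i
  ⊕-comm i j = cong (_mod n) (+-comm (toℕ i) (toℕ j))

  ⊕-assoc : Associative _≡_ _⊕_
  ⊕-assoc i j k = begin
    (i ⊕ j) ⊕ k                          ≡⟨ mod-⊕ (toℕ i + toℕ j) k ⟩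
    (toℕ i + toℕ j + toℕ k) mod n        ≡⟨ cong (_mod n) (trans (+-assoc (toℕ i) (toℕ j) (toℕ k)) (+-comm (toℕ i) _)) ⟩
    (toℕ j + toℕ k + toℕ i) mod n        ≡⟨ mod-⊕ (toℕ j + toℕ k) i ⟨
    (j ⊕ k) ⊕ i                          ≡⟨ ⊕-comm (j ⊕ k) i ⟩
    i ⊕ (j ⊕ k)                          ∎

  ⊕-identityˡ : LeftIdentity _≡_ 𝟘 _⊕_
  ⊕-identityˡ i = trans (mod-⊕ 0 i) (mod-toℕ i)

  ⊕-identityʳ : RightIdentity _≡_ 𝟘 _⊕_
  ⊕-identityʳ i = trans (⊕-comm i 𝟘) (⊕-identityˡ i)

  ⊕-inverseˡ : LeftInverse _≡_ 𝟘 ⊖_ _⊕_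
  ⊕-inverseˡ i = begin
    ⊖ i ⊕ i                        ≡⟨ mod-⊕ (n ∸ toℕ i) i ⟩
    (n ∸ toℕ i + toℕ i) mod n      ≡⟨ cong (_mod n) (trans (+-comm (n ∸ toℕ i) _) (m+[n∸m]≡n (toℕ≤n i))) ⟩
    n mod n                        ≡⟨ mod-cong (trans (n%n≡0 n) (sym (0%n≡0))) ⟩
    𝟘                              ∎
    where
    0%n≡0 : 0 % n ≡ 0
    0%n≡0 = trans (cong (_% n) (sym (n%n≡0 n))) (trans (m%n%n≡m%n n n) (n%n≡0 n))

  ⊕-inverseʳ : RightInverse _≡_ 𝟘 ⊖_ _⊕_
  ⊕-inverseʳ i = trans (⊕-comm i (⊖ i)) (⊕-inverseˡ i)

  ℤ/ : FiniteGroup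
  ℤ/ = record
    { Carrier = Fin n
    ; _∙_     = _⊕_
    ; ε       = 𝟘
    ; _⁻¹     = ⊖_
    ; isGroup = record
      { isMonoid = record
        { isSemigroup = record
          { isMagma = record { isEquivalence = isEquivalence ; ∙-cong = cong₂ _⊕_ }
          ; assoc   = ⊕-assoc
          }
        ; identity = ⊕-identityˡ , ⊕-identityʳ
        }
      ; inverse = ⊕-inverseˡ , ⊕-inverseʳ
      ; ⁻¹-cong = cong ⊖_
      }
    ; order       = n
    ; enumeration = ↔-id (Fin n)
    }

enumerateVec : ∀ {A : Set} {n} → Fin n ↔ A → ∀ r → Fin (n ^ r) ↔ Vec A r
enumerateVec e zero    =
  ↔-trans 1↔⊤ (mk↔ₛ′ (λ _ → []) (λ _ → tt) (λ { [] → refl }) (λ _ → refl))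
enumerateVec e (suc r) =
  ↔-trans *↔× (↔-trans (e ×-↔ enumerateVec e r)
    (mk↔ₛ′ (uncurry _∷_) (λ { (x ∷ xs) → x , xs }) (λ { (_ ∷ _) → refl }) (λ _ → refl)))

infixl 8 _^ᴳ_

_^ᴳ_ : FiniteGroup → ℕ → FiniteGroup
G ^ᴳ r = record
  { Carrier = Vec Carrier r
  ; _∙_     = zipWith _∙_
  ; ε       = replicate r ε
  ; _⁻¹     = map _⁻¹
  ; isGroup = record
    { isMonoid = record
      { isSemigroup = record
        { isMagma = record { isEquivalence = isEquivalence ; ∙-cong = cong₂ (zipWith _∙_) }
        ; assoc   = zipWith-assoc assoc
        }
      ; identity = zipWith-identityˡ identityˡ , zipWith-identityʳ identityʳ
      }
    ; inverse = zipWith-inverseˡ inverseˡ , zipWith-inverseʳ inverseʳ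
    ; ⁻¹-cong = cong (map _⁻¹)
    }
  ; order       = order ^ r
  ; enumeration = enumerateVec enumeration r
  }
  where
  open FiniteGroup G
  open IsGroup isGroup using (assoc; identityˡ; identityʳ; inverseˡ; inverseʳ)

{-# OPTIONS --safe #-}
module Submission where

-- Let φ : Cay(V; S) ≅ Cay(V; S′) with V = (ℤ/p)ʳ and p odd, and put e₁ = (1, 0) in
-- W = (ℤ/p)².  In W × V connect by the symmetric closure of
--   0 × V  ∪  e₁ × S  ∪  {(0, 1), (1, 1)} × 0.
-- Then id × φ is an isomorphism of the Cayley graphs built from S and S′, so the CI
-- property gives an automorphism β of W × V carrying one connection set to the other.
-- If β preserves 0 × V, then β maps e₁ × V to ±e₁ × V, because this fibre holds at least
-- two elements of the connection set (0 is added to S when S is a singleton), and it maps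
-- the points (0, 1) × 0 and (1, 1) × 0 to points of the zero section.  Hence it also maps
-- e₁ × 0 into the zero section, so the restriction of ±β to V carries S to S′.
--
-- β preserves 0 × V because a subgroup inside the connection set has a projection to W
-- inside the support {0, ±(1, 0), ±(0, 1), ±(1, 1)}.  For p ≥ 5 no nonzero element of the
-- support has its double in the support.  For p = 3 the projection may be a line, but then
-- 3ʳ⁻¹ elements of the subgroup lie in one fibre, which is too small.
--
-- For p = 2 every subset is symmetric, and the DCI property is inherited by a hyperplane.

open import Defs
open import Algebra.Bundles using (Group; AbelianGroup)
open import Algebra.Morphism.Structures using (module GroupMorphisms)
import Algebra.Properties.AbelianGroup as AbelianGroupProperties
import Algebra.Properties.CommutativeSemigroup as CommutativeSemigroupProperties
import Algebra.Properties.Group as GroupProperties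
open import Algebra.Structures using (IsGroup)
open import Data.Bool.Base using (Bool; true; false; T; _∨_)
open import Data.Bool.Properties using (T?; T-∨)
open import Data.Fin.Base using (Fin; zero; suc; combine)
import Data.Fin.Properties as Fin
open import Data.Fin.Subset using (∣_∣)
open import Data.Nat.Base using (ℕ; zero; suc; _+_; _*_; _∸_; _^_; _≤_; _<_; z≤n; s≤s; NonZero)
import Data.Nat.Properties as ℕ
open import Data.Nat.DivMod using (_mod_)
open import Data.Nat.Primality using (Prime; ¬prime[0]; ¬prime[1]; composite⇒¬prime; composite[4])
open import Data.Product.Base using (∃; _×_; _,_; proj₁; proj₂)
open import Data.Vec.Base using (Vec; []; _∷_; tabulate; head; tail)
open import Data.Vec.Properties using (zipWith-comm; ∷-injectiveˡ; ∷-injectiveʳ)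
open import Data.Sum.Base as Sum using (_⊎_; inj₁; inj₂; [_,_]′)
open import Function.Base using (_∘_; id)
open import Function.Bundles using (_⇔_; mk⇔; Equivalence; Inverse)
open import Function.Definitions using (Injective; StrictlySurjective)
open import Level using (0ℓ)
open import Relation.Binary.Definitions using (DecidableEquality)
open import Relation.Binary.Morphism.Structures using (module IsOrderIsomorphism)
open import Relation.Binary.PropositionalEquality
open import Relation.Nullary.Decidable using (Dec; yes; no; ⌊_⌋; toWitness; fromWitness; _⊎-dec_; _×-dec_; _→-dec_; ¬?; map′; from-yes; decidable-stable)
open import Relation.Nullary.Negation using (¬_; contradiction)
open import Relation.Unary using (Pred; Decidable)

open Equivalence using (to; from)

-- Ranks of the members of a finite subset.

tabulate-rank : ∀ {n} (b : Fin n → Bool) i → T (b i) → Fin ∣ tabulate b ∣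
tabulate-rank b zero    t with true ← b zero = zero
tabulate-rank b (suc i) t with b zero
... | true  = suc (tabulate-rank (b ∘ suc) i t)
... | false = tabulate-rank (b ∘ suc) i t

-- The rank of a true position counts the true entries before it. Injectivity turns a bound on
-- `card` into a pigeonhole argument.
tabulate-rank-injective : ∀ {n} (b : Fin n → Bool) {i j} t u →
  tabulate-rank b i t ≡ tabulate-rank b j u → i ≡ j
tabulate-rank-injective b {zero}  {zero}  t u eq = refl
tabulate-rank-injective b {zero}  {suc j} t u eq with true ← b zero with () ← eq
tabulate-rank-injective b {suc i} {zero}  t u eq with true ← b zero with () ← eq
tabulate-rank-injective b {suc i} {suc j} t u eq with b zero
... | true  = cong suc (tabulate-rank-injective (b ∘ suc) t u (Fin.suc-injective eq))
... | false = cong suc (tabulate-rank-injective (b ∘ suc) t u eq)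

-- Automorphisms and Cayley isomorphisms of a finite group.

module FiniteGroups (G : FiniteGroup) where
  open FiniteGroup G
  open IsGroup isGroup using (identityˡ; identityʳ; inverseˡ; inverseʳ; assoc; _//_)

  group : Group 0ℓ 0ℓ
  group = record { isGroup = isGroup }

  open GroupProperties group
  open ≡-Reasoning

  private
    point : Fin order → Carrier
    point = Inverse.to enumeration

    index : Carrier → Fin order
    index = Inverse.from enumeration

    point-index : ∀ x → point (index x) ≡ x
    point-index = Inverse.strictlyInverseˡ enumeration

    index-injective : Injective _≡_ _≡_ index
    index-injective eq = trans (sym (point-index _)) (trans (cong point eq) (point-index _))

    point-injective : Injective _≡_ _≡_ point
    point-injective eq = trans (sym (Inverse.strictlyInverseʳ enumeration _))
      (trans (cong index eq) (Inverse.strictlyInverseʳ enumeration _))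

  any-element? : ∀ {P : Pred Carrier 0ℓ} → Decidable P → Dec (∃ P)
  any-element? {P} P? = map′
    (λ (i , q) → point i , q)
    (λ (x , q) → index x , subst P (sym (point-index x)) q)
    (Fin.any? (P? ∘ point))

  infix 4 _≟_
  _≟_ : DecidableEquality Carrier
  x ≟ y = map′ index-injective (cong index) (index x Fin.≟ index y)

  -- Pigeonhole: a missed `y`, put in front of the values of `f`, would embed `suc order` elements
  -- into `order`.
  injective⇒strictlySurjective : ∀ {f} → Injective _≡_ _≡_ f → StrictlySurjective _≡_ f
  injective⇒strictlySurjective {f} f-inj y with any-element? (λ x → f x ≟ y)
  ... | yes hit  = hit
  ... | no  miss = contradiction (Fin.injective⇒≤ extended-injective) ℕ.1+n≰n
    where
    extended : Fin (suc order) → Fin order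
    extended zero    = index y
    extended (suc i) = index (f (point i))

    extended-injective : Injective _≡_ _≡_ extended
    extended-injective {zero}  {zero}  _  = refl
    extended-injective {zero}  {suc j} eq = contradiction (point j , sym (index-injective eq)) miss
    extended-injective {suc i} {zero}  eq = contradiction (point i , index-injective eq) miss
    extended-injective {suc i} {suc j} eq =
      cong suc (point-injective (f-inj (index-injective eq)))

  injective⇒order≤ : ∀ {m} {f : Carrier → Fin m} → Injective _≡_ _≡_ f → order ≤ m
  injective⇒order≤ f-inj = Fin.injective⇒≤ (λ eq → point-injective (f-inj eq))

  rank : (S : Subset G) (x : Carrier) → T (S x) → Fin (card G S)
  rank S x x∈S = tabulate-rank (S ∘ point) (index x) (subst (T ∘ S) (sym (point-index x)) x∈S)

  rank-injective : ∀ S {x y} x∈S y∈S → rank S x x∈S ≡ rank S y y∈S → x ≡ y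
  rank-injective S x∈S y∈S eq = index-injective (tabulate-rank-injective (S ∘ point) _ _ eq)

  AtLeastTwo : Subset G → Set
  AtLeastTwo S = ∃ λ s → ∃ λ t → T (S s) × T (S t) × s ≢ t

  -- An automorphism carrying `S` onto `S′`, reduced to an injective homomorphism with a pointwise
  -- membership condition. Finiteness supplies surjectivity, so constructing one takes only these
  -- data.
  record Transport (S S′ : Subset G) : Set where
    field
      fun       : Carrier → Carrier
      homo      : ∀ x y → fun (x ∙ y) ≡ fun x ∙ fun y
      injective : Injective _≡_ _≡_ fun
      member    : ∀ x → T (S x) ⇔ T (S′ (fun x))

    strictlySurjective : StrictlySurjective _≡_ fun
    strictlySurjective = injective⇒strictlySurjective injective

    fun-ε : fun ε ≡ ε
    fun-ε = identityʳ-unique (fun ε) (fun ε)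
      (trans (sym (homo ε ε)) (cong fun (identityˡ ε)))

    fun-⁻¹ : ∀ x → fun (x ⁻¹) ≡ fun x ⁻¹
    fun-⁻¹ x = inverseˡ-unique (fun (x ⁻¹)) (fun x)
      (trans (sym (homo (x ⁻¹) x)) (trans (cong fun (inverseˡ x)) fun-ε))

    fun-// : ∀ x y → fun (x // y) ≡ fun x // fun y
    fun-// x y = trans (homo x (y ⁻¹)) (cong (fun x ∙_) (fun-⁻¹ y))

  module _ {S S′ : Subset G} where

    automorphismEquivalent⇒transport : AutomorphismEquivalent G S S′ → Transport S S′
    automorphismEquivalent⇒transport (α , α-auto , image⊆ , image⊇) = record
      { fun       = α
      ; homo      = ∙-homo
      ; injective = injective
      ; member    = λ x → mk⇔
          (λ x∈S → image⊆ (x , x∈S , refl))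
          (λ αx∈S′ → let (x₁ , x₁∈S , eq) = image⊇ αx∈S′
                     in subst (T ∘ S) (sym (injective eq)) x₁∈S)
      }
      where
      open GroupMorphisms.IsGroupIsomorphism α-auto

    transport⇒automorphismEquivalent : Transport S S′ → AutomorphismEquivalent G S S′
    transport⇒automorphismEquivalent t =
      fun ,
      record
        { isGroupMonomorphism = record
          { isGroupHomomorphism = record
            { isMonoidHomomorphism = record
              { isMagmaHomomorphism = record
                { isRelHomomorphism = record { cong = cong fun } ; homo = homo }
              ; ε-homo = fun-ε
              }
            ; ⁻¹-homo = fun-⁻¹
            }
          ; injective = injective
          }
        ; surjective = λ y → let (x , eq) = strictlySurjective y in x , λ { refl → eq }
        } ,
      (λ { (x , x∈S , refl) → to (member x) x∈S }) ,
      (λ {y} y∈S′ → let (x , eq) = strictlySurjective y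
                    in x , from (member x) (subst (T ∘ S′) (sym eq) y∈S′) , sym eq)
      where open Transport t

    transport-sym : Transport S S′ → Transport S′ S
    transport-sym t = record
      { fun       = inv
      ; homo      = λ x y → injective (begin
          fun (inv (x ∙ y))         ≡⟨ fun-inv (x ∙ y) ⟩
          x ∙ y                     ≡⟨ cong₂ _∙_ (fun-inv x) (fun-inv y) ⟨
          fun (inv x) ∙ fun (inv y) ≡⟨ homo (inv x) (inv y) ⟨
          fun (inv x ∙ inv y)       ∎)
      ; injective = λ {x} {y} eq → trans (sym (fun-inv x)) (trans (cong fun eq) (fun-inv y))
      ; member    = λ y → mk⇔
          (λ y∈S′ → from (member (inv y)) (subst (T ∘ S′) (sym (fun-inv y)) y∈S′))
          (λ x∈S → subst (T ∘ S′) (fun-inv y) (to (member (inv y)) x∈S))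
      }
      where
      open Transport t
      inv : Carrier → Carrier
      inv y = proj₁ (strictlySurjective y)
      fun-inv : ∀ y → fun (inv y) ≡ y
      fun-inv y = proj₂ (strictlySurjective y)

  homo∧trivialKernel⇒injective : ∀ {f : Carrier → Carrier} →
    (∀ x y → f (x ∙ y) ≡ f x ∙ f y) → (∀ x → f x ≡ ε → x ≡ ε) → Injective _≡_ _≡_ f
  homo∧trivialKernel⇒injective {f} homo kernel {x} {y} eq =
    x∙y⁻¹≈ε⇒x≈y x y (kernel (x // y) (begin
      f (x // y)               ≡⟨ //-rightDividesʳ (f y) (f (x // y)) ⟨
      (f (x // y) ∙ f y) // f y ≡⟨ cong (_// f y) (homo (x // y) y) ⟨
      f ((x // y) ∙ y) // f y   ≡⟨ cong (λ z → f z // f y) (//-rightDividesˡ y x) ⟩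
      f x // f y               ≡⟨ x≈y⇒x∙y⁻¹≈ε eq ⟩
      ε                        ∎))

  -- Adjacency of `g` and `h` is expressed by the quotient `h // g`, which removes the existential
  -- witness from the edge relation of `Cay`.
  record CayleyIso (S S′ : Subset G) : Set where
    field
      fun                : Carrier → Carrier
      injective          : Injective _≡_ _≡_ fun
      strictlySurjective : StrictlySurjective _≡_ fun
      edge               : ∀ g h → T (S (h // g)) ⇔ T (S′ (fun h // fun g))

    -- The identity lies in a connection set exactly when the vertices carry loops, and isomorphisms
    -- preserve and reflect loops.
    zero-member : T (S ε) ⇔ T (S′ ε)
    zero-member = subst₂ (λ x y → T (S x) ⇔ T (S′ y))
      (inverseʳ ε) (inverseʳ (fun ε)) (edge ε ε)

  edge⇔difference : ∀ (S : Subset G) g h → (∃ λ s → T (S s) × h ≡ s ∙ g) ⇔ T (S (h // g))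
  edge⇔difference S g h = mk⇔
    (λ { (s , s∈S , refl) → subst (T ∘ S) (sym (//-rightDividesʳ g s)) s∈S })
    (λ h/g∈S → h // g , h/g∈S , sym (//-rightDividesˡ g h))

  ≅⇒cayleyIso : ∀ {S S′} → Cay G S ≅ Cay G S′ → CayleyIso S S′
  ≅⇒cayleyIso {S} {S′} (φ , iso) = record
    { fun                = φ
    ; injective          = injective
    ; strictlySurjective = λ y → let (x , hit) = surjective y in x , hit refl
    ; edge               = λ g h → mk⇔
        (to (edge⇔difference S′ (φ g) (φ h)) ∘ mono ∘ from (edge⇔difference S g h))
        (to (edge⇔difference S g h) ∘ cancel ∘ from (edge⇔difference S′ (φ g) (φ h)))
    }
    where
    open IsOrderIsomorphism iso

  cayleyIso⇒≅ : ∀ {S S′} → CayleyIso S S′ → Cay G S ≅ Cay G S′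
  cayleyIso⇒≅ {S} {S′} i = fun , record
    { isOrderMonomorphism = record
      { isOrderHomomorphism = record
        { cong = cong fun
        ; mono = λ {g} {h} → from (edge⇔difference S′ (fun g) (fun h)) ∘ to (edge g h)
                           ∘ to (edge⇔difference S g h)
        }
      ; injective = injective
      ; cancel    = λ {g} {h} → from (edge⇔difference S g h) ∘ from (edge g h)
                              ∘ to (edge⇔difference S′ (fun g) (fun h))
      }
    ; surjective = λ y → let (x , eq) = strictlySurjective y in x , λ { refl → eq }
    }
    where open CayleyIso i

  -- The members of `S` are the out-neighbours of `ε`. They go to distinct out-neighbours of
  -- `fun ε`, which are translated back to members of `S′`.
  atLeastTwo-cayleyIso : ∀ {S S′} → CayleyIso S S′ → AtLeastTwo S → AtLeastTwo S′
  atLeastTwo-cayleyIso {S} iso (s , t , s∈S , t∈S , s≢t) =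
    fun s // fun ε , fun t // fun ε , transfer s s∈S , transfer t t∈S ,
    s≢t ∘ injective ∘ ∙-cancelʳ (fun ε ⁻¹) (fun s) (fun t)
    where
    open CayleyIso iso
    transfer : ∀ x → T (S x) → _
    transfer x = to (edge ε x) ∘ subst (T ∘ S)
      (sym (trans (cong (x ∙_) ε⁻¹≈ε) (identityʳ x)))

  -- Adding loops gives a set with a nonidentity member the two elements that the descent requires.
  insertε : Subset G → Subset G
  insertε S x = S x ∨ ⌊ x ≟ ε ⌋

  insertε⇔ : ∀ S x → T (insertε S x) ⇔ (T (S x) ⊎ x ≡ ε)
  insertε⇔ S x = mk⇔
    (λ t → Sum.map₂ (toWitness {a? = x ≟ ε}) (to (T-∨ {S x}) t))
    (λ t → from (T-∨ {S x}) (Sum.map₂ (fromWitness {a? = x ≟ ε}) t))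

  cayleyIso-insertε : ∀ {S S′} → CayleyIso S S′ → CayleyIso (insertε S) (insertε S′)
  cayleyIso-insertε {S} {S′} iso = record
    { fun                = fun
    ; injective          = injective
    ; strictlySurjective = strictlySurjective
    ; edge               = λ g h → mk⇔
        (from (insertε⇔ S′ (fun h // fun g))
          ∘ Sum.map (to (edge g h)) (x≈y⇒x∙y⁻¹≈ε ∘ cong fun ∘ x∙y⁻¹≈ε⇒x≈y h g)
          ∘ to (insertε⇔ S (h // g)))
        (from (insertε⇔ S (h // g))
          ∘ Sum.map (from (edge g h)) (x≈y⇒x∙y⁻¹≈ε ∘ injective ∘ x∙y⁻¹≈ε⇒x≈y (fun h) (fun g))
          ∘ to (insertε⇔ S′ (fun h // fun g)))
    }
    where open CayleyIso iso

  -- An injective homomorphism sends `ε`, and nothing else, to `ε`. The insertion hides only the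
  -- membership of `ε`, and the hypothesis restores it.
  transport-deleteε : ∀ {S S′} → T (S ε) ⇔ T (S′ ε) →
    Transport (insertε S) (insertε S′) → Transport S S′
  transport-deleteε {S} {S′} S⇔S′ t = record
    { fun       = fun
    ; homo      = homo
    ; injective = injective
    ; member    = λ x → mk⇔ (preserves x) (reflects x)
    }
    where
    open Transport t
    preserves : ∀ x → T (S x) → T (S′ (fun x))
    preserves x x∈S with to (insertε⇔ S′ (fun x)) (to (member x) (from (insertε⇔ S x) (inj₁ x∈S)))
    ... | inj₁ fx∈S′ = fx∈S′
    ... | inj₂ fx≡ε  = subst (T ∘ S′) (sym fx≡ε)
          (to S⇔S′ (subst (T ∘ S) (injective (trans fx≡ε (sym fun-ε))) x∈S))
    reflects : ∀ x → T (S′ (fun x)) → T (S x)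
    reflects x fx∈S′ with to (insertε⇔ S x) (from (member x) (from (insertε⇔ S′ (fun x)) (inj₁ fx∈S′)))
    ... | inj₁ x∈S = x∈S
    ... | inj₂ refl = from S⇔S′ (subst (T ∘ S′) fun-ε fx∈S′)

  -- Every edge of `Cay S` is a loop. A member `x` of `S′` gives an edge from `fun ε` to
  -- `x ∙ fun ε`; its preimage is a loop, so `x` is `ε`. Then `zero-member` shows that the identity
  -- map carries `S` to `S′`.
  transport-⊆ε : ∀ {S S′} → (∀ x → T (S x) → x ≡ ε) → CayleyIso S S′ → Transport S S′
  transport-⊆ε {S} {S′} S⊆ε iso = record
    { fun       = id
    ; homo      = λ _ _ → refl
    ; injective = id
    ; member    = λ x → mk⇔
        (λ x∈S → subst (T ∘ S′) (sym (S⊆ε x x∈S)) (to zero-member (subst (T ∘ S) (S⊆ε x x∈S) x∈S)))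
        (λ x∈S′ → subst (T ∘ S) (sym (S′⊆ε x x∈S′))
          (from zero-member (subst (T ∘ S′) (S′⊆ε x x∈S′) x∈S′)))
    }
    where
    open CayleyIso iso
    S′⊆ε : ∀ x → T (S′ x) → x ≡ ε
    S′⊆ε x x∈S′ = begin
      x                 ≡⟨ //-rightDividesʳ (fun ε) x ⟨
      (x ∙ fun ε) // fun ε ≡⟨ cong (_// fun ε) hit ⟨
      fun y // fun ε    ≡⟨ x≈y⇒x∙y⁻¹≈ε (cong fun y≡ε) ⟩
      ε                 ∎
      where
      y : Carrier
      y = proj₁ (strictlySurjective (x ∙ fun ε))
      hit : fun y ≡ x ∙ fun ε
      hit = proj₂ (strictlySurjective (x ∙ fun ε))
      y≡ε : y ≡ ε
      y≡ε = x∙y⁻¹≈ε⇒x≈y y ε (S⊆ε (y // ε) (from (edge ε y)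
        (subst (T ∘ S′) (trans (sym (//-rightDividesʳ (fun ε) x)) (cong (_// fun ε) (sym hit))) x∈S′)))

cyclic : (p : ℕ) .{{_ : NonZero p}} → AbelianGroup 0ℓ 0ℓ
cyclic p = record
  { isAbelianGroup = record { isGroup = FiniteGroup.isGroup (ℤ/ p) ; comm = ⊕-comm p } }

elementary : (p : ℕ) .{{_ : NonZero p}} → ℕ → AbelianGroup 0ℓ 0ℓ
elementary p n = record
  { isAbelianGroup = record
    { isGroup = FiniteGroup.isGroup (ℤ/ p ^ᴳ n) ; comm = zipWith-comm (⊕-comm p) }
  }

-- The symmetric connection set in `W × V`.

module Connection (p : ℕ) .{{_ : NonZero p}} (r : ℕ) where

  0ᵖ 1ᵖ : Fin p
  0ᵖ = 𝟘 p
  1ᵖ = 1 mod p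

  module Z = AbelianGroup (cyclic p)
  module V = AbelianGroup (elementary p r)
  module W = AbelianGroup (elementary p 2)
  module E = AbelianGroup (elementary p (2 + r))
  module Z-Properties = AbelianGroupProperties (cyclic p)
  module V-Properties = AbelianGroupProperties (elementary p r)
  module W-Properties = AbelianGroupProperties (elementary p 2)
  module E-Properties = AbelianGroupProperties (elementary p (2 + r))
  module V-Finite = FiniteGroups (ℤ/ p ^ᴳ r)
  module E-Finite = FiniteGroups (ℤ/ p ^ᴳ (2 + r))
  open V-Finite using (CayleyIso; Transport)

  SubsetV SubsetE : Set
  SubsetV = Subset (ℤ/ p ^ᴳ r)
  SubsetE = Subset (ℤ/ p ^ᴳ (2 + r))

  base : E.Carrier → W.Carrier
  base (a ∷ b ∷ v) = a ∷ b ∷ []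

  fibre : E.Carrier → V.Carrier
  fibre (a ∷ b ∷ v) = v

  ι : V.Carrier → E.Carrier
  ι v = 0ᵖ ∷ 0ᵖ ∷ v

  e₁ : W.Carrier
  e₁ = 1ᵖ ∷ 0ᵖ ∷ []

  base-∙ : ∀ x y → base (x E.∙ y) ≡ base x W.∙ base y
  base-∙ (_ ∷ _ ∷ _) (_ ∷ _ ∷ _) = refl

  base-⁻¹ : ∀ x → base (x E.⁻¹) ≡ base x W.⁻¹
  base-⁻¹ (_ ∷ _ ∷ _) = refl

  base-minus : ∀ x y → base (x E.- y) ≡ base x W.- base y
  base-minus (_ ∷ _ ∷ _) (_ ∷ _ ∷ _) = refl

  fibre-∙ : ∀ x y → fibre (x E.∙ y) ≡ fibre x V.∙ fibre y
  fibre-∙ (_ ∷ _ ∷ _) (_ ∷ _ ∷ _) = refl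

  fibre-⁻¹ : ∀ x → fibre (x E.⁻¹) ≡ fibre x V.⁻¹
  fibre-⁻¹ (_ ∷ _ ∷ _) = refl

  fibre-minus : ∀ x y → fibre (x E.- y) ≡ fibre x V.- fibre y
  fibre-minus (_ ∷ _ ∷ _) (_ ∷ _ ∷ _) = refl

  base-fibre-injective : ∀ {x y} → base x ≡ base y → fibre x ≡ fibre y → x ≡ y
  base-fibre-injective {_ ∷ _ ∷ _} {_ ∷ _ ∷ _} refl refl = refl

  ι-∙ : ∀ v w → ι (v V.∙ w) ≡ ι v E.∙ ι w
  ι-∙ v w = cong (λ a → a ∷ a ∷ v V.∙ w) (sym (Z.identityˡ 0ᵖ))

  ι-fibre : ∀ {x} → base x ≡ W.ε → ι (fibre x) ≡ x
  ι-fibre {_ ∷ _ ∷ _} refl = refl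

  Half : SubsetV → Pred E.Carrier 0ℓ
  Half S (a ∷ b ∷ v) =
    (a ≡ 0ᵖ × b ≡ 0ᵖ) ⊎
    (a ≡ 1ᵖ × b ≡ 0ᵖ × T (S v)) ⊎
    (v ≡ V.ε × b ≡ 1ᵖ × (a ≡ 0ᵖ ⊎ a ≡ 1ᵖ))

  half? : ∀ S → Decidable (Half S)
  half? S (a ∷ b ∷ v) =
    ((a Fin.≟ 0ᵖ) ×-dec (b Fin.≟ 0ᵖ)) ⊎-dec
    ((a Fin.≟ 1ᵖ) ×-dec (b Fin.≟ 0ᵖ) ×-dec T? (S v)) ⊎-dec
    ((v V-Finite.≟ V.ε) ×-dec (b Fin.≟ 1ᵖ) ×-dec ((a Fin.≟ 0ᵖ) ⊎-dec (a Fin.≟ 1ᵖ)))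

  Conn : SubsetV → Pred E.Carrier 0ℓ
  Conn S x = Half S x ⊎ Half S (x E.⁻¹)

  connection : SubsetV → SubsetE
  connection S x = ⌊ half? S x ⊎-dec half? S (x E.⁻¹) ⌋

  connection⇔Conn : ∀ S x → T (connection S x) ⇔ Conn S x
  connection⇔Conn S x = mk⇔ toWitness fromWitness

  conn-⁻¹ : ∀ {S x} → Conn S x → Conn S (x E.⁻¹)
  conn-⁻¹ {S} {x} = [ inj₂ ∘ subst (Half S) (sym (E-Properties.⁻¹-involutive x)) , inj₁ ]′

  conn-⁻¹-⇔ : ∀ {S x} → Conn S x ⇔ Conn S (x E.⁻¹)
  conn-⁻¹-⇔ {S} {x} = mk⇔ conn-⁻¹ (subst (Conn S) (E-Properties.⁻¹-involutive x) ∘ conn-⁻¹)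

  connection-symmetric : ∀ S → Symmetric (ℤ/ p ^ᴳ (2 + r)) (connection S)
  connection-symmetric S =
    (λ {x} x∈T → x E.⁻¹ ,
      from (connection⇔Conn S (x E.⁻¹)) (conn-⁻¹ (to (connection⇔Conn S x) x∈T)) ,
      sym (E-Properties.⁻¹-involutive x)) ,
    λ { (x , x∈T , refl) →
      from (connection⇔Conn S (x E.⁻¹)) (conn-⁻¹ (to (connection⇔Conn S x) x∈T)) }

  conn-ι : ∀ {S} v → Conn S (ι v)
  conn-ι v = inj₁ (inj₁ (refl , refl))

  -- Only the pieces over `0` and `e₁`, and the negatives of these, leave the zero section. This
  -- case split locates the image of a point under an unknown automorphism.
  conn⇒fibre≡ε⊎base : ∀ {S} x → Conn S x →
    fibre x ≡ V.ε ⊎ base x ≡ W.ε ⊎ base x ≡ e₁ ⊎ base x ≡ e₁ W.⁻¹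
  conn⇒fibre≡ε⊎base {S} x = [ positive , negative ]′
    where
    half : ∀ y → Half S y → fibre y ≡ V.ε ⊎ base y ≡ W.ε ⊎ base y ≡ e₁
    half (_ ∷ _ ∷ _) (inj₁ (refl , refl))            = inj₂ (inj₁ refl)
    half (_ ∷ _ ∷ _) (inj₂ (inj₁ (refl , refl , _))) = inj₂ (inj₂ refl)
    half (_ ∷ _ ∷ _) (inj₂ (inj₂ (v≡ε , _)))         = inj₁ v≡ε

    positive : Half S x → _
    positive h with half x h
    ... | inj₁ eq        = inj₁ eq
    ... | inj₂ (inj₁ eq) = inj₂ (inj₁ eq)
    ... | inj₂ (inj₂ eq) = inj₂ (inj₂ (inj₁ eq))

    negative : Half S (x E.⁻¹) → _
    negative h with half (x E.⁻¹) h
    ... | inj₁ eq        = inj₁ (V-Properties.⁻¹-injective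
            (trans (sym (fibre-⁻¹ x)) (trans eq (sym V-Properties.ε⁻¹≈ε))))
    ... | inj₂ (inj₁ eq) = inj₂ (inj₁ (W-Properties.⁻¹-injective
            (trans (sym (base-⁻¹ x)) (trans eq (sym W-Properties.ε⁻¹≈ε)))))
    ... | inj₂ (inj₂ eq) = inj₂ (inj₂ (inj₂
            (trans (sym (W-Properties.⁻¹-involutive (base x)))
              (cong W._⁻¹ (trans (sym (base-⁻¹ x)) eq)))))

  -- The map `Φ` keeps all base differences. In the fibre the three pieces ask for nothing, for a
  -- difference in `S`, or for equality; an isomorphism respects each of these.
  lift : ∀ {S S′} → CayleyIso S S′ → E-Finite.CayleyIso (connection S) (connection S′)
  lift {S} {S′} iso = record
    { fun                = Φ
    ; injective          = λ
        { {_ ∷ _ ∷ _} {_ ∷ _ ∷ _} eq → base-fibre-injective (cong base eq) (φ.injective (cong fibre eq)) }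
    ; strictlySurjective = λ { (a ∷ b ∷ v) → let (u , eq) = φ.strictlySurjective v
                                             in a ∷ b ∷ u , cong (λ v → a ∷ b ∷ v) eq }
    ; edge               = λ g h → mk⇔
        (from (connection⇔Conn S′ (Φ h E.- Φ g)) ∘ to (conn-edge g h) ∘ to (connection⇔Conn S (h E.- g)))
        (from (connection⇔Conn S (h E.- g)) ∘ from (conn-edge g h) ∘ to (connection⇔Conn S′ (Φ h E.- Φ g)))
    }
    where
    module φ = CayleyIso iso
    open V-Properties using (x≈y⇒x∙y⁻¹≈ε; x∙y⁻¹≈ε⇒x≈y)

    Φ : E.Carrier → E.Carrier
    Φ (a ∷ b ∷ v) = a ∷ b ∷ φ.fun v

    half-edge : ∀ g h → Half S (h E.- g) ⇔ Half S′ (Φ h E.- Φ g)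
    half-edge (_ ∷ _ ∷ u) (_ ∷ _ ∷ v) = mk⇔
      (λ { (inj₁ eqs) → inj₁ eqs
         ; (inj₂ (inj₁ (eq₁ , eq₂ , ∈S))) → inj₂ (inj₁ (eq₁ , eq₂ , to (φ.edge u v) ∈S))
         ; (inj₂ (inj₂ (eq , eqs))) →
             inj₂ (inj₂ (x≈y⇒x∙y⁻¹≈ε (cong φ.fun (x∙y⁻¹≈ε⇒x≈y v u eq)) , eqs)) })
      (λ { (inj₁ eqs) → inj₁ eqs
         ; (inj₂ (inj₁ (eq₁ , eq₂ , ∈S′))) → inj₂ (inj₁ (eq₁ , eq₂ , from (φ.edge u v) ∈S′))
         ; (inj₂ (inj₂ (eq , eqs))) →
             inj₂ (inj₂ (x≈y⇒x∙y⁻¹≈ε (φ.injective (x∙y⁻¹≈ε⇒x≈y (φ.fun v) (φ.fun u) eq)) , eqs)) })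

    conn-edge : ∀ g h → Conn S (h E.- g) ⇔ Conn S′ (Φ h E.- Φ g)
    conn-edge g h = mk⇔
      [ inj₁ ∘ to (half-edge g h)
      -- The inverse of a difference is the difference in the other order, so the negative half is
      -- the positive half with `g` and `h` exchanged.
      , inj₂ ∘ subst (Half S′) (sym (⁻¹-anti-homo-// (Φ h) (Φ g))) ∘ to (half-edge h g)
             ∘ subst (Half S) (⁻¹-anti-homo-// h g) ]′
      [ inj₁ ∘ from (half-edge g h)
      , inj₂ ∘ subst (Half S) (sym (⁻¹-anti-homo-// h g)) ∘ from (half-edge h g)
             ∘ subst (Half S′) (⁻¹-anti-homo-// (Φ h) (Φ g)) ]′
      where open E-Properties using (⁻¹-anti-homo-//)

  -- Isolates the preservation of `0 × V`, for which `p = 3` and `p ≥ 5` need different arguments;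
  -- the descent to `V` is common to both.
  Rigid : SubsetV → SubsetV → Set
  Rigid S S′ = (β : E-Finite.Transport (connection S) (connection S′)) →
    ∀ v → base (E-Finite.Transport.fun β (ι v)) ≡ W.ε

  conn-fun-ι : ∀ {S S′} (β : E-Finite.Transport (connection S) (connection S′)) v →
    Conn S′ (E-Finite.Transport.fun β (ι v))
  conn-fun-ι {S} {S′} β v = to (connection⇔Conn S′ (fun (ι v)))
    (to (member (ι v)) (from (connection⇔Conn S (ι v)) (conn-ι {S} v)))
    where open E-Finite.Transport β

  -- Connection sets are closed under inverses, so the sign of an automorphism is free. This reduces
  -- an image of `e₁` over `-e₁` to one over `e₁`.
  negate : ∀ {S S′} → E-Finite.Transport (connection S) (connection S′) →
    E-Finite.Transport (connection S) (connection S′)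
  negate {S} {S′} t = record
    { fun       = λ x → fun x E.⁻¹
    ; homo      = λ x y → trans (cong E._⁻¹ (homo x y)) (sym (⁻¹-∙-comm (fun x) (fun y)))
    ; injective = injective ∘ ⁻¹-injective
    ; member    = λ x → mk⇔
        (from (connection⇔Conn S′ (fun x E.⁻¹)) ∘ to conn-⁻¹-⇔
          ∘ to (connection⇔Conn S′ (fun x)) ∘ to (member x))
        (from (member x) ∘ from (connection⇔Conn S′ (fun x)) ∘ from conn-⁻¹-⇔
          ∘ to (connection⇔Conn S′ (fun x E.⁻¹)))
    }
    where
    open E-Finite.Transport t
    open E-Properties using (⁻¹-∙-comm; ⁻¹-injective)

  -- Descent of an automorphism from `W × V` to `V`.

  module FibrePreserving {S S′} (rigid : Rigid S S′)
    (β : E-Finite.Transport (connection S) (connection S′)) where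
    open E-Finite.Transport β public
    open ≡-Reasoning

    conn : ∀ x → Conn S x ⇔ Conn S′ (fun x)
    conn x = mk⇔
      (to (connection⇔Conn S′ (fun x)) ∘ to (member x) ∘ from (connection⇔Conn S x))
      (to (connection⇔Conn S x) ∘ from (member x) ∘ from (connection⇔Conn S′ (fun x)))

    fun-V : V.Carrier → V.Carrier
    fun-V v = fibre (fun (ι v))

    fun-ι : ∀ v → fun (ι v) ≡ ι (fun-V v)
    fun-ι v = sym (ι-fibre (rigid β v))

    fun-V-homo : ∀ v w → fun-V (v V.∙ w) ≡ fun-V v V.∙ fun-V w
    fun-V-homo v w = begin
      fibre (fun (ι (v V.∙ w)))             ≡⟨ cong (fibre ∘ fun) (ι-∙ v w) ⟩
      fibre (fun (ι v E.∙ ι w))             ≡⟨ cong fibre (homo (ι v) (ι w)) ⟩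
      fibre (fun (ι v) E.∙ fun (ι w))       ≡⟨ fibre-∙ (fun (ι v)) (fun (ι w)) ⟩
      fun-V v V.∙ fun-V w                   ∎

    fun-V-injective : Injective _≡_ _≡_ fun-V
    fun-V-injective {v} {w} eq = cong fibre (injective {ι v} {ι w}
      (trans (fun-ι v) (trans (cong ι eq) (sym (fun-ι w)))))

    base-fun-ε : ∀ {x} → base x ≡ W.ε → base (fun x) ≡ W.ε
    base-fun-ε {x} eq = trans (cong (base ∘ fun) (sym (ι-fibre eq))) (rigid β (fibre x))

    -- The restriction `fun-V` is injective on a finite set, hence onto. A point sent into `0 × V`
    -- therefore shares its image with a point of `0 × V`, and injectivity identifies the two.
    base-fun-ε⁻¹ : ∀ {x} → base (fun x) ≡ W.ε → base x ≡ W.ε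
    base-fun-ε⁻¹ {x} eq =
      let (v , hit) = V-Finite.injective⇒strictlySurjective fun-V-injective (fibre (fun x))
      in cong base (injective {x} {ι v}
           (trans (sym (ι-fibre eq)) (trans (cong ι (sym hit)) (sym (fun-ι v)))))

    base-fun-minus : ∀ x y → base (fun (x E.- y)) ≡ base (fun x) W.- base (fun y)
    base-fun-minus x y = trans (cong base (fun-// x y)) (base-minus (fun x) (fun y))

    -- Together with `base-fun-cancel`: the automorphism induces a well-defined injective map on the
    -- quotient `W`.
    base-fun-cong : ∀ {x y} → base x ≡ base y → base (fun x) ≡ base (fun y)
    base-fun-cong {x} {y} eq = x∙y⁻¹≈ε⇒x≈y _ _
      (trans (sym (base-fun-minus x y))
        (base-fun-ε (trans (base-minus x y) (x≈y⇒x∙y⁻¹≈ε eq))))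
      where open W-Properties

    base-fun-cancel : ∀ {x y} → base (fun x) ≡ base (fun y) → base x ≡ base y
    base-fun-cancel {x} {y} eq = x∙y⁻¹≈ε⇒x≈y _ _
      (trans (sym (base-minus x y))
        (base-fun-ε⁻¹ (trans (base-fun-minus x y) (x≈y⇒x∙y⁻¹≈ε eq))))
      where open W-Properties

  module Odd (1≢0 : 1ᵖ ≢ 0ᵖ) (1≢-1 : 1ᵖ ≢ 1ᵖ Z.⁻¹) where

    ⊖0≡0 : 0ᵖ Z.⁻¹ ≡ 0ᵖ
    ⊖0≡0 = Z-Properties.ε⁻¹≈ε

    ⊖≡0⇒≡0 : ∀ {a} → a Z.⁻¹ ≡ 0ᵖ → a ≡ 0ᵖ
    ⊖≡0⇒≡0 eq = Z-Properties.⁻¹-injective (trans eq (sym ⊖0≡0))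

    -- Lets `S` be read off from the fibre over `e₁`. No other piece reaches this fibre because
    -- `1 ≢ 0`, and the negative of the `S` piece misses it because `1 ≢ -1`.
    conn-e₁ : ∀ S v → Conn S (1ᵖ ∷ 0ᵖ ∷ v) ⇔ T (S v)
    conn-e₁ S v = mk⇔
      (λ { (inj₁ (inj₁ (eq , _)))            → contradiction eq 1≢0
         ; (inj₁ (inj₂ (inj₁ (_ , _ , v∈S)))) → v∈S
         ; (inj₁ (inj₂ (inj₂ (_ , eq , _))))  → contradiction (sym eq) 1≢0
         ; (inj₂ (inj₁ (eq , _)))            → contradiction (⊖≡0⇒≡0 eq) 1≢0
         ; (inj₂ (inj₂ (inj₁ (eq , _))))      → contradiction (sym eq) 1≢-1
         ; (inj₂ (inj₂ (inj₂ (_ , eq , _))))  → contradiction (trans (sym eq) ⊖0≡0) 1≢0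
         })
      (λ v∈S → inj₁ (inj₂ (inj₁ (refl , refl , v∈S))))

    module Oriented {S S′} (rigid : Rigid S S′)
      (β : E-Finite.Transport (connection S) (connection S′))
      (orientation : base (E-Finite.Transport.fun β (1ᵖ ∷ 0ᵖ ∷ V.ε)) ≡ e₁) where
      open FibrePreserving rigid β
      open ≡-Reasoning

      -- The induced map on `W` is injective and fixes `0`, `e₁` and `-e₁`. A point with second
      -- coordinate `1` lies over none of these, so neither does its image, and elsewhere the
      -- connection set lies in the zero section.
      fibre-point : ∀ a v → Conn S (a ∷ 1ᵖ ∷ v) → fibre (fun (a ∷ 1ᵖ ∷ v)) ≡ V.ε
      fibre-point a v c with conn⇒fibre≡ε⊎base _ (to (conn (a ∷ 1ᵖ ∷ v)) c)
      ... | inj₁ eq = eq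
      ... | inj₂ (inj₁ eq) = contradiction
              (∷-injectiveˡ (∷-injectiveʳ (base-fun-ε⁻¹ {a ∷ 1ᵖ ∷ v} eq))) 1≢0
      ... | inj₂ (inj₂ (inj₁ eq)) = contradiction
              (∷-injectiveˡ (∷-injectiveʳ
                (base-fun-cancel {a ∷ 1ᵖ ∷ v} {1ᵖ ∷ 0ᵖ ∷ V.ε} (trans eq (sym orientation))))) 1≢0
      ... | inj₂ (inj₂ (inj₂ eq)) = contradiction
              (⊖≡0⇒≡0 (∷-injectiveˡ (∷-injectiveʳ
                (base-fun-cancel {(a ∷ 1ᵖ ∷ v) E.⁻¹} {1ᵖ ∷ 0ᵖ ∷ V.ε} (begin
                  base (fun ((a ∷ 1ᵖ ∷ v) E.⁻¹)) ≡⟨ cong base (fun-⁻¹ (a ∷ 1ᵖ ∷ v)) ⟩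
                  base (fun (a ∷ 1ᵖ ∷ v) E.⁻¹)   ≡⟨ base-⁻¹ (fun (a ∷ 1ᵖ ∷ v)) ⟩
                  base (fun (a ∷ 1ᵖ ∷ v)) W.⁻¹   ≡⟨ cong W._⁻¹ eq ⟩
                  e₁ W.⁻¹ W.⁻¹                   ≡⟨ W-Properties.⁻¹-involutive e₁ ⟩
                  e₁                             ≡⟨ orientation ⟨
                  base (fun (1ᵖ ∷ 0ᵖ ∷ V.ε))     ∎))))) 1≢0

      -- (1, 0) = (1, 1) - (0, 1), and β maps the points over (1, 1) and (0, 1)
      -- to points of the zero section.
      fibre-e₁ : fibre (fun (1ᵖ ∷ 0ᵖ ∷ V.ε)) ≡ V.ε
      fibre-e₁ = begin
        fibre (fun (1ᵖ ∷ 0ᵖ ∷ V.ε))            ≡⟨ cong (fibre ∘ fun) e₁-difference ⟩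
        fibre (fun (x E.- y))                  ≡⟨ cong fibre (fun-// x y) ⟩
        fibre (fun x E.- fun y)                ≡⟨ fibre-minus (fun x) (fun y) ⟩
        fibre (fun x) V.- fibre (fun y)        ≡⟨ cong₂ V._-_ (fibre-point 1ᵖ V.ε x∈T) (fibre-point 0ᵖ V.ε y∈T) ⟩
        V.ε V.- V.ε                            ≡⟨ V.inverseʳ V.ε ⟩
        V.ε                                    ∎
        where
        x y : E.Carrier
        x = 1ᵖ ∷ 1ᵖ ∷ V.ε
        y = 0ᵖ ∷ 1ᵖ ∷ V.ε
        x∈T : Conn S x
        x∈T = inj₁ (inj₂ (inj₂ (refl , refl , inj₂ refl)))
        y∈T : Conn S y
        y∈T = inj₁ (inj₂ (inj₂ (refl , refl , inj₁ refl)))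
        e₁-difference : 1ᵖ ∷ 0ᵖ ∷ V.ε ≡ x E.- y
        e₁-difference = cong₂ _∷_
          (sym (trans (cong (1ᵖ Z.∙_) ⊖0≡0) (Z.identityʳ 1ᵖ)))
          (cong₂ _∷_ (sym (Z.inverseʳ 1ᵖ)) (sym (V.inverseʳ V.ε)))

      fun-e₁ : ∀ v → fun (1ᵖ ∷ 0ᵖ ∷ v) ≡ 1ᵖ ∷ 0ᵖ ∷ fun-V v
      fun-e₁ v = base-fibre-injective
        (trans (base-fun-cong {1ᵖ ∷ 0ᵖ ∷ v} {1ᵖ ∷ 0ᵖ ∷ V.ε} refl) orientation)
        (begin
          fibre (fun (1ᵖ ∷ 0ᵖ ∷ v))
            ≡⟨ cong (fibre ∘ fun) (cong₂ _∷_ (sym (Z.identityʳ 1ᵖ))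
                 (cong₂ _∷_ (sym (Z.identityʳ 0ᵖ)) (sym (V.identityˡ v)))) ⟩
          fibre (fun ((1ᵖ ∷ 0ᵖ ∷ V.ε) E.∙ ι v))
            ≡⟨ cong fibre (homo (1ᵖ ∷ 0ᵖ ∷ V.ε) (ι v)) ⟩
          fibre (fun (1ᵖ ∷ 0ᵖ ∷ V.ε) E.∙ fun (ι v))
            ≡⟨ fibre-∙ (fun (1ᵖ ∷ 0ᵖ ∷ V.ε)) (fun (ι v)) ⟩
          fibre (fun (1ᵖ ∷ 0ᵖ ∷ V.ε)) V.∙ fun-V v
            ≡⟨ cong (V._∙ fun-V v) fibre-e₁ ⟩
          V.ε V.∙ fun-V v
            ≡⟨ V.identityˡ (fun-V v) ⟩
          fun-V v ∎)

      transport-V : Transport S S′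
      transport-V = record
        { fun       = fun-V
        ; homo      = fun-V-homo
        ; injective = fun-V-injective
        ; member    = λ v → mk⇔
            (to (conn-e₁ S′ (fun-V v)) ∘ subst (Conn S′) (fun-e₁ v)
              ∘ to (conn (1ᵖ ∷ 0ᵖ ∷ v)) ∘ from (conn-e₁ S v))
            (to (conn-e₁ S v) ∘ from (conn (1ᵖ ∷ 0ᵖ ∷ v))
              ∘ subst (Conn S′) (sym (fun-e₁ v)) ∘ from (conn-e₁ S′ (fun-V v)))
        }

    descend : ∀ {S S′} → Rigid S S′ → V-Finite.AtLeastTwo S →
      E-Finite.Transport (connection S) (connection S′) → Transport S S′
    descend {S} {S′} rigid (s , t , s∈S , t∈S , s≢t) β = by-fibre
      (conn⇒fibre≡ε⊎base _ (to (conn x) (from (conn-e₁ S s) s∈S)))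
      (conn⇒fibre≡ε⊎base _ (to (conn y) (from (conn-e₁ S t) t∈S)))
      where
      open FibrePreserving rigid β
      x y o : E.Carrier
      x = 1ᵖ ∷ 0ᵖ ∷ s
      y = 1ᵖ ∷ 0ᵖ ∷ t
      o = 1ᵖ ∷ 0ᵖ ∷ V.ε

      by-base : ∀ z → base z ≡ e₁ →
        base (fun z) ≡ W.ε ⊎ base (fun z) ≡ e₁ ⊎ base (fun z) ≡ e₁ W.⁻¹ → Transport S S′
      by-base z z↦e₁ (inj₁ eq) =
        contradiction (∷-injectiveˡ (trans (sym z↦e₁) (base-fun-ε⁻¹ {z} eq))) 1≢0
      by-base z z↦e₁ (inj₂ (inj₁ eq)) = Oriented.transport-V rigid β
        (trans (base-fun-cong {o} {z} (sym z↦e₁)) eq)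
      by-base z z↦e₁ (inj₂ (inj₂ eq)) = Oriented.transport-V rigid (negate β)
        (trans (base-⁻¹ (fun o))
          (trans (cong W._⁻¹ (trans (base-fun-cong {o} {z} (sym z↦e₁)) eq))
            (W-Properties.⁻¹-involutive e₁)))

      by-fibre : fibre (fun x) ≡ V.ε ⊎ _ → fibre (fun y) ≡ V.ε ⊎ _ → Transport S S′
      by-fibre (inj₂ eqs) _          = by-base x refl eqs
      by-fibre (inj₁ _)   (inj₂ eqs) = by-base y refl eqs
      -- The two images have the same base, so they would coincide if both lay in the zero section.
      by-fibre (inj₁ eq₁) (inj₁ eq₂) = contradiction
        (cong fibre (injective {x} {y} (base-fibre-injective
          (base-fun-cong {x} {y} refl) (trans eq₁ (sym eq₂))))) s≢t

    -- The automorphism is inverted before the descent and the result is inverted back. Rigidity for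
    -- `p = 3` bounds the fibres of the target, and the size bound is given for `S`, so `S` has to
    -- be the target.
    resolve : IsCIGroup (ℤ/ p ^ᴳ (2 + r)) → ∀ {S S′} →
      CayleyIso S S′ → V-Finite.AtLeastTwo S → Rigid S′ S → Transport S S′
    resolve ci {S} {S′} iso two rigid = V-Finite.transport-sym
      (descend rigid (V-Finite.atLeastTwo-cayleyIso iso two)
        (E-Finite.transport-sym (E-Finite.automorphismEquivalent⇒transport
          (ci (connection S) (connection-symmetric S) (connection S′) (connection-symmetric S′)
            (E-Finite.cayleyIso⇒≅ (lift iso))))))

-- Modulus at least five: rigidity by doubling.

module AtLeastFive (k r : ℕ) where
  open Connection (5 + k) r
  open Z-Properties

  1≢0 : 1ᵖ ≢ 0ᵖ
  1≢0 ()

  2≢0 : 1ᵖ Z.∙ 1ᵖ ≢ 0ᵖ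
  2≢0 ()

  2≢1 : 1ᵖ Z.∙ 1ᵖ ≢ 1ᵖ
  2≢1 ()

  3≢0 : (1ᵖ Z.∙ 1ᵖ) Z.∙ 1ᵖ ≢ 0ᵖ
  3≢0 ()

  open Odd 1≢0 (λ 1≡-1 → 2≢0 (trans (cong (1ᵖ Z.∙_) 1≡-1) (Z.inverseʳ 1ᵖ)))

  -- The set `{0, 1, -1}` contains both base coordinates of every connection element. This coarser
  -- bound on the support lets doubling be tested one coordinate at a time.
  Unit : Fin (5 + k) → Set
  Unit a = a ≡ 0ᵖ ⊎ a ≡ 1ᵖ ⊎ a ≡ 1ᵖ Z.⁻¹

  unit-⁻¹ : ∀ {a} → Unit (a Z.⁻¹) → Unit a
  unit-⁻¹ (inj₁ eq)        = inj₁ (⊖≡0⇒≡0 eq)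
  unit-⁻¹ (inj₂ (inj₁ eq)) = inj₂ (inj₂ (trans (sym (⁻¹-involutive _)) (cong Z._⁻¹ eq)))
  unit-⁻¹ (inj₂ (inj₂ eq)) = inj₂ (inj₁ (⁻¹-injective eq))

  -- If `2` were `0`, `1` or `-1`, the modulus would divide `2`, `1` or `3`.
  ¬unit-2 : ¬ Unit (1ᵖ Z.∙ 1ᵖ)
  ¬unit-2 (inj₁ eq)        = 2≢0 eq
  ¬unit-2 (inj₂ (inj₁ eq)) = 2≢1 eq
  ¬unit-2 (inj₂ (inj₂ eq)) = 3≢0 (trans (cong (Z._∙ 1ᵖ) eq) (Z.inverseˡ 1ᵖ))

  unit∧unit-double⇒0 : ∀ {a} → Unit a → Unit (a Z.∙ a) → a ≡ 0ᵖ
  unit∧unit-double⇒0 (inj₁ eq)          _ = eq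
  unit∧unit-double⇒0 (inj₂ (inj₁ refl)) u = contradiction u ¬unit-2
  unit∧unit-double⇒0 (inj₂ (inj₂ refl)) u =
    contradiction (unit-⁻¹ (subst Unit (⁻¹-∙-comm 1ᵖ 1ᵖ) u)) ¬unit-2

  half⇒units : ∀ {S} x → Half S x → Unit (head x) × Unit (head (tail x))
  half⇒units (_ ∷ _ ∷ _) (inj₁ (eq₁ , eq₂))                     = inj₁ eq₁ , inj₁ eq₂
  half⇒units (_ ∷ _ ∷ _) (inj₂ (inj₁ (eq₁ , eq₂ , _)))          = inj₂ (inj₁ eq₁) , inj₁ eq₂
  half⇒units (_ ∷ _ ∷ _) (inj₂ (inj₂ (_ , eq₂ , inj₁ eq₁)))     = inj₁ eq₁ , inj₂ (inj₁ eq₂)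
  half⇒units (_ ∷ _ ∷ _) (inj₂ (inj₂ (_ , eq₂ , inj₂ eq₁)))     = inj₂ (inj₁ eq₁) , inj₂ (inj₁ eq₂)

  conn⇒units : ∀ {S} x → Conn S x → Unit (head x) × Unit (head (tail x))
  conn⇒units {S} x               (inj₁ h) = half⇒units {S} x h
  conn⇒units {S} x@(_ ∷ _ ∷ _) (inj₂ h) =
    let (u₁ , u₂) = half⇒units {S} (x E.⁻¹) h in unit-⁻¹ u₁ , unit-⁻¹ u₂

  rigid : ∀ S S′ → Rigid S S′
  rigid S S′ β v = by-doubling (fun (ι v)) (conn-fun-ι β v)
    -- The double of `fun (ι v)` is the image of `ι (v V.∙ v)`, hence also a connection element.
    (subst (Conn S′) (trans (cong fun (ι-∙ v v)) (homo (ι v) (ι v))) (conn-fun-ι β (v V.∙ v)))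
    where
    open E-Finite.Transport β
    by-doubling : ∀ x → Conn S′ x → Conn S′ (x E.∙ x) → base x ≡ W.ε
    by-doubling x@(_ ∷ _ ∷ _) c cc =
      let (u₁ , u₂) = conn⇒units {S′} x c ; (uu₁ , uu₂) = conn⇒units {S′} (x E.∙ x) cc
      in cong₂ (λ a b → a ∷ b ∷ []) (unit∧unit-double⇒0 u₁ uu₁) (unit∧unit-double⇒0 u₂ uu₂)

  CI⇒DCI : IsCIGroup (ℤ/ (5 + k) ^ᴳ (2 + r)) → IsDCIGroup (ℤ/ (5 + k) ^ᴳ r)
  CI⇒DCI ci S S′ Γ≅Γ′ = transport⇒automorphismEquivalent transport
    where
    open V-Finite
    iso : CayleyIso S S′
    iso = ≅⇒cayleyIso Γ≅Γ′

    transport : Transport S S′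
    transport with any-element? (λ s → T? (S s) ×-dec ¬? (s ≟ V.ε))
    ... | no  none = transport-⊆ε (λ x x∈S → decidable-stable (x ≟ V.ε) (λ x≢ε → none (x , x∈S , x≢ε))) iso
    -- After insertion `s` and `ε` are two distinct members, whether or not `ε` was in `S` before.
    ... | yes (s , s∈S , s≢ε) = transport-deleteε (CayleyIso.zero-member iso)
      (resolve ci (cayleyIso-insertε iso)
        (s , V.ε , from (insertε⇔ S s) (inj₁ s∈S) , from (insertε⇔ S V.ε) (inj₂ refl) , s≢ε)
        (rigid (insertε S′) (insertε S)))

-- The prime three: rigidity by counting.

module Three (r : ℕ) where
  open Connection 3 r
  open Odd (λ ()) (λ ())

  HalfSupport : W.Carrier → Set
  HalfSupport w = w ≡ W.ε ⊎ w ≡ e₁ ⊎ w ≡ 0ᵖ ∷ 1ᵖ ∷ [] ⊎ w ≡ 1ᵖ ∷ 1ᵖ ∷ []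

  Support : W.Carrier → Set
  Support w = HalfSupport w ⊎ HalfSupport (w W.⁻¹)

  module W-Finite = FiniteGroups (ℤ/ 3 ^ᴳ 2)

  support? : Decidable Support
  support? w = half-support? w ⊎-dec half-support? (w W.⁻¹)
    where
    open W-Finite using (_≟_)
    half-support? : Decidable HalfSupport
    half-support? w = (w ≟ W.ε) ⊎-dec (w ≟ e₁) ⊎-dec (w ≟ 0ᵖ ∷ 1ᵖ ∷ []) ⊎-dec (w ≟ 1ᵖ ∷ 1ᵖ ∷ [])

  conn⇒support : ∀ {S} x → Conn S x → Support (base x)
  conn⇒support {S} x = Sum.map (half x) (subst HalfSupport (base-⁻¹ x) ∘ half (x E.⁻¹))
    where
    half : ∀ y → Half S y → HalfSupport (base y)
    half (_ ∷ _ ∷ _) (inj₁ (refl , refl))                     = inj₁ refl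
    half (_ ∷ _ ∷ _) (inj₂ (inj₁ (refl , refl , _)))          = inj₂ (inj₁ refl)
    half (_ ∷ _ ∷ _) (inj₂ (inj₂ (_ , refl , inj₁ refl)))     = inj₂ (inj₂ (inj₁ refl))
    half (_ ∷ _ ∷ _) (inj₂ (inj₂ (_ , refl , inj₂ refl)))     = inj₂ (inj₂ (inj₂ refl))

  -- Adds the multiple `c` of `x` to `y`. It is generic in the operation so that one formula serves
  -- in `V` and in `W` and passes through homomorphisms.
  translate : ∀ {A : Set} → (A → A → A) → A → Fin 3 → A → A
  translate _·_ x zero             y = y
  translate _·_ x (suc zero)       y = y · x
  translate _·_ x (suc (suc zero)) y = (y · x) · x

  -- The support is the plane without ±(1, -1), so it contains no two independent
  -- elements together with their sum and difference.
  support-line : ∀ w w′ → w ≢ W.ε → Support w →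
    (∀ c → Support (translate W._∙_ w c w′)) →
    ∃ λ c → translate W._∙_ w c w′ ≡ w
  support-line (a ∷ b ∷ []) (a′ ∷ b′ ∷ []) = from-yes
    (Fin.all? λ a → Fin.all? λ b → Fin.all? λ a′ → Fin.all? λ b′ →
      let w = a ∷ b ∷ [] ; w′ = a′ ∷ b′ ∷ [] in
      (¬? (w ≟ W.ε)) →-dec (support? w →-dec ((Fin.all? λ c → support? (translate W._∙_ w c w′)) →-dec
        (Fin.any? λ c → translate W._∙_ w c w′ ≟ w))))
    a b a′ b′
    where open W-Finite using (_≟_)

  translate-homo : ∀ {A B : Set} {_·_ : A → A → A} {_∗_ : B → B → B} {f : A → B} →
    (∀ x y → f (x · y) ≡ f x ∗ f y) →
    ∀ x c y → f (translate _·_ x c y) ≡ translate _∗_ (f x) c (f y)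
  translate-homo homo x zero             y = refl
  translate-homo homo x (suc zero)       y = homo y x
  translate-homo {_·_ = _·_} {_∗_} {f} homo x (suc (suc zero)) y =
    trans (homo (y · x) x) (cong (_∗ f x) (homo y x))

  translate-injective : ∀ x c → Injective _≡_ _≡_ (translate V._∙_ x c)
  translate-injective x zero             eq = eq
  translate-injective x (suc zero)       eq = V-Properties.∙-cancelʳ x _ _ eq
  translate-injective x (suc (suc zero)) eq =
    V-Properties.∙-cancelʳ x _ _ (V-Properties.∙-cancelʳ x _ _ eq)

  -- An upper bound on the number of members, given as an injection into `Fin size`. It is kept
  -- apart from `card` because the singleton case supplies the bound `2` for `insertε S` directly.
  record Ranking (S : SubsetV) : Set where
    field
      size           : ℕ
      size-bound     : 3 * size < 3 ^ r
      nonempty       : ∃ λ s → T (S s)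
      rank           : ∀ v → T (S v) → Fin size
      rank-injective : ∀ {v w} v∈S w∈S → rank v v∈S ≡ rank w w∈S → v ≡ w

  module _ {S′ : SubsetV} (ranking : Ranking S′) where
    open Ranking ranking

    -- Over `e₁` the connection set is a copy of `S′`, over `-e₁` a copy of its negative, and over
    -- any other nonzero base it has at most one element.
    fibre-rank : ∀ {w} → w ≢ W.ε → ∃ λ (f : ∀ x → Conn S′ x → base x ≡ w → Fin size) →
      ∀ {x y} cx cy x↦w y↦w → f x cx x↦w ≡ f y cy y↦w → fibre x ≡ fibre y
    fibre-rank {w} w≢ε with w W-Finite.≟ e₁ | w W-Finite.≟ e₁ W.⁻¹
    ... | yes refl | _ =
      (λ { x@(_ ∷ _ ∷ v) c refl → rank v (to (conn-e₁ S′ v) c) }) ,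
      λ { {_ ∷ _ ∷ _} {_ ∷ _ ∷ _} cx cy refl refl eq → rank-injective _ _ eq }
    ... | no _ | yes refl =
      (λ { x@(_ ∷ _ ∷ v) c refl → rank (v V.⁻¹) (to (conn-e₁ S′ (v V.⁻¹)) (conn-⁻¹ {S′} {x} c)) }) ,
      λ { {_ ∷ _ ∷ _} {_ ∷ _ ∷ _} cx cy refl refl eq → V-Properties.⁻¹-injective (rank-injective _ _ eq) }
    ... | no w≢e₁ | no w≢-e₁ =
      -- A constant rank suffices for at most one element; `nonempty` provides a value in
      -- `Fin size`.
      (λ _ _ _ → rank _ (proj₂ nonempty)) ,
      λ cx cy x↦w y↦w _ → trans (fibre≡ε cx x↦w) (sym (fibre≡ε cy y↦w))
      where
      fibre≡ε : ∀ {x} → Conn S′ x → base x ≡ w → fibre x ≡ V.ε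
      fibre≡ε {x} c x↦w with conn⇒fibre≡ε⊎base x c
      ... | inj₁ eq               = eq
      ... | inj₂ (inj₁ eq)        = contradiction (trans (sym x↦w) eq) w≢ε
      ... | inj₂ (inj₂ (inj₁ eq)) = contradiction (trans (sym x↦w) eq) w≢e₁
      ... | inj₂ (inj₂ (inj₂ eq)) = contradiction (trans (sym x↦w) eq) w≢-e₁

    -- If `h v₀` were nonzero, `v` would be determined by the multiple of `v₀` that aligns it and by
    -- the rank of the aligned point. This embeds the `3 ^ r` elements of `V` into `3 * size`,
    -- against `size-bound`.
    rigid : ∀ S → Rigid S S′
    rigid S β v₀ = decidable-stable (base (fun (ι v₀)) W-Finite.≟ W.ε) λ w≢ε →
      ℕ.<⇒≱ size-bound (V-Finite.injective⇒order≤ (code-injective w≢ε))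
      where
      open E-Finite.Transport β
      h : V.Carrier → W.Carrier
      h v = base (fun (ι v))

      h-homo : ∀ u v → h (u V.∙ v) ≡ h u W.∙ h v
      h-homo u v = trans (cong (base ∘ fun) (ι-∙ u v))
        (trans (cong base (homo (ι u) (ι v))) (base-∙ (fun (ι u)) (fun (ι v))))

      h-translate : ∀ c v → h (translate V._∙_ v₀ c v) ≡ translate W._∙_ (h v₀) c (h v)
      h-translate = translate-homo h-homo v₀

      -- If h v₀ ≠ 0, then h takes all its values on the line through h v₀, and each v
      -- has a translate by a multiple of v₀ over h v₀ itself.
      module _ (w≢ε : h v₀ ≢ W.ε) where
        line : ∀ v → ∃ λ c → translate W._∙_ (h v₀) c (h v) ≡ h v₀
        line v = support-line (h v₀) (h v) w≢ε (conn⇒support {S′} _ (conn-fun-ι β v₀)) λ c →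
          subst Support (h-translate c v)
            (conn⇒support {S′} _ (conn-fun-ι β (translate V._∙_ v₀ c v)))

        aligned : V.Carrier → V.Carrier
        aligned v = translate V._∙_ v₀ (proj₁ (line v)) v

        h-aligned : ∀ v → h (aligned v) ≡ h v₀
        h-aligned v = trans (h-translate (proj₁ (line v)) v) (proj₂ (line v))

        code : V.Carrier → Fin (3 * size)
        code v = combine (proj₁ (line v))
          (proj₁ (fibre-rank w≢ε) (fun (ι (aligned v))) (conn-fun-ι β (aligned v)) (h-aligned v))

        code-injective : Injective _≡_ _≡_ code
        code-injective {u} {v} eq =
          let (c≡ , rank≡) = Fin.combine-injective (proj₁ (line u)) _ (proj₁ (line v)) _ eq
              fibre≡ = proj₂ (fibre-rank w≢ε) (conn-fun-ι β (aligned u)) (conn-fun-ι β (aligned v))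
                         (h-aligned u) (h-aligned v) rank≡
              aligned≡ = cong fibre (injective {ι (aligned u)} {ι (aligned v)}
                (base-fibre-injective (trans (h-aligned u) (sym (h-aligned v))) fibre≡))
          in translate-injective v₀ (proj₁ (line u))
               (trans aligned≡ (cong (λ c → translate V._∙_ v₀ c v) (sym c≡)))

  CI⇒smallDCI : IsCIGroup (ℤ/ 3 ^ᴳ (2 + r)) →
    ∀ S → card (ℤ/ 3 ^ᴳ r) S < 3 ^ (r ∸ 1) → IsDCIDigraph (ℤ/ 3 ^ᴳ r) S
  CI⇒smallDCI ci S |S|<3^[r-1] S′ Γ≅Γ′ = transport⇒automorphismEquivalent transport
    where
    open V-Finite
    iso : CayleyIso S S′
    iso = ≅⇒cayleyIso Γ≅Γ′

    1≤|S| : ∀ s → T (S s) → 1 ≤ card (ℤ/ 3 ^ᴳ r) S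
    1≤|S| s s∈S = ℕ.≤-trans (s≤s z≤n) (Fin.toℕ<n (rank S s s∈S))

    -- For `r = 0` the truncated exponent makes the bound `m < 1`, which contradicts `0 < m`.
    3*m<3^r : ∀ {m} r → 0 < m → m < 3 ^ (r ∸ 1) → 3 * m < 3 ^ r
    3*m<3^r zero    0<m m<1 = contradiction (ℕ.<-≤-trans m<1 0<m) (ℕ.<-irrefl refl)
    3*m<3^r (suc r) 0<m m<  = ℕ.*-monoʳ-< 3 m<

    3*2<3^r : ∀ {m} r → 0 < m → m < 3 ^ (r ∸ 1) → 3 * 2 < 3 ^ r
    3*2<3^r zero          0<m m<1 = contradiction (ℕ.<-≤-trans m<1 0<m) (ℕ.<-irrefl refl)
    3*2<3^r (suc zero)    0<m m<1 = contradiction (ℕ.<-≤-trans m<1 0<m) (ℕ.<-irrefl refl)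
    3*2<3^r (suc (suc r)) 0<m m<  =
      -- The chain is `7 ≤ 7 + 2 = 9`, and `9` is at most `3 ^ r` once `r` is at least `2`.
      ℕ.<-≤-trans (ℕ.m≤m+n 7 2) (ℕ.*-monoʳ-≤ 3 (ℕ.*-monoʳ-≤ 3 (ℕ.m^n>0 3 r)))

    transport : Transport S S′
    transport with any-element? (λ s → T? (S s) ×-dec ¬? (s ≟ V.ε))
    ... | no  none = transport-⊆ε (λ x x∈S → decidable-stable (x ≟ V.ε) (λ x≢ε → none (x , x∈S , x≢ε))) iso
    ... | yes (s , s∈S , s≢ε) with any-element? (λ t → T? (S t) ×-dec ¬? (s ≟ t))
    ...   | yes (t , t∈S , s≢t) = resolve ci iso (s , t , s∈S , t∈S , s≢t) (rigid (record
            { size           = card (ℤ/ 3 ^ᴳ r) S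
            ; size-bound     = 3*m<3^r r (1≤|S| s s∈S) |S|<3^[r-1]
            ; nonempty       = s , s∈S
            ; rank           = rank S
            ; rank-injective = rank-injective S
            }) S′)
    -- Here `S` is the singleton of `s`, and `insertε S` has just the members `s` and `ε`. In the
    -- previous case `S` is kept as it is, since one more element could exhaust the strict size
    -- bound.
    ...   | no  only-s = transport-deleteε (CayleyIso.zero-member iso)
            (resolve ci (cayleyIso-insertε iso)
              (s , V.ε , s∈Sε , ε∈Sε , s≢ε)
              (rigid (record
                { size           = 2
                ; size-bound     = 3*2<3^r r (1≤|S| s s∈S) |S|<3^[r-1]
                ; nonempty       = s , s∈Sε
                ; rank           = λ v _ → bit (v ≟ V.ε)
                ; rank-injective = λ {v} {w} → bit-injective (v ≟ V.ε) (w ≟ V.ε)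
                }) (insertε S′)))
            where
            s∈Sε : T (insertε S s)
            s∈Sε = from (insertε⇔ S s) (inj₁ s∈S)

            ε∈Sε : T (insertε S V.ε)
            ε∈Sε = from (insertε⇔ S V.ε) (inj₂ refl)

            bit : ∀ {v} → Dec (v ≡ V.ε) → Fin 2
            bit (yes _) = zero
            bit (no  _) = suc zero

            nonzero⇒s : ∀ v → T (insertε S v) → v ≢ V.ε → s ≡ v
            nonzero⇒s v v∈Sε v≢ε with to (insertε⇔ S v) v∈Sε
            ... | inj₁ v∈S = decidable-stable (s ≟ v) (λ s≢v → only-s (v , v∈S , s≢v))
            ... | inj₂ v≡ε = contradiction v≡ε v≢ε

            bit-injective : ∀ {v w} (v≟ε : Dec (v ≡ V.ε)) (w≟ε : Dec (w ≡ V.ε)) →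
              T (insertε S v) → T (insertε S w) → bit v≟ε ≡ bit w≟ε → v ≡ w
            bit-injective (yes v≡ε) (yes w≡ε) _    _    _ = trans v≡ε (sym w≡ε)
            bit-injective (no  v≢ε) (no  w≢ε) v∈Sε w∈Sε _ =
              trans (sym (nonzero⇒s _ v∈Sε v≢ε)) (nonzero⇒s _ w∈Sε w≢ε)

-- The prime two: symmetry of all subsets and restriction to a hyperplane.

module Two where

  module _ (n : ℕ) where
    open AbelianGroup (elementary 2 n) using
      (Carrier; _∙_; ε; _⁻¹; identityˡ; identityʳ; inverseʳ; commutativeSemigroup)
    open AbelianGroupProperties (elementary 2 n) using (inverseˡ-unique)
    open ≡-Reasoning

    x⁻¹≡x : ∀ {m} (x : Vec (Fin 2) m) → FiniteGroup._⁻¹ (ℤ/ 2 ^ᴳ m) x ≡ x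
    x⁻¹≡x []                = refl
    x⁻¹≡x (zero     ∷ x)    = cong (zero ∷_) (x⁻¹≡x x)
    x⁻¹≡x (suc zero ∷ x)    = cong (suc zero ∷_) (x⁻¹≡x x)

    x∙x≡ε : ∀ x → x ∙ x ≡ ε
    x∙x≡ε x = trans (cong (x ∙_) (sym (x⁻¹≡x x))) (inverseʳ x)

    CI⇒DCI : IsCIGroup (ℤ/ 2 ^ᴳ n) → IsDCIGroup (ℤ/ 2 ^ᴳ n)
    CI⇒DCI ci S S′ = ci S (symmetric S) S′ (symmetric S′)
      where
      symmetric : ∀ S → Symmetric (ℤ/ 2 ^ᴳ n) S
      symmetric S =
        (λ {x} x∈S → x , x∈S , sym (x⁻¹≡x x)) ,
        λ { (x , x∈S , refl) → subst (T ∘ S) (sym (x⁻¹≡x x)) x∈S }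

    private
      module V-Finite = FiniteGroups (ℤ/ 2 ^ᴳ n)
      module E = AbelianGroup (elementary 2 (suc n))
      module E-Finite = FiniteGroups (ℤ/ 2 ^ᴳ (suc n))

    extend : Subset (ℤ/ 2 ^ᴳ n) → Subset (ℤ/ 2 ^ᴳ (suc n))
    extend S (zero  ∷ v) = S v
    extend S (suc _ ∷ v) = false

    -- The Cayley digraph of `extend S` is two disjoint copies of that of `S`, one for each first
    -- coordinate, and the isomorphism acts on both copies alike.
    extend-iso : ∀ {S S′} → V-Finite.CayleyIso S S′ → E-Finite.CayleyIso (extend S) (extend S′)
    extend-iso {S} {S′} iso = record
      { fun                = λ { (a ∷ v) → a ∷ fun v }
      ; injective          = λ { {_ ∷ _} {_ ∷ _} eq →
          cong₂ _∷_ (∷-injectiveˡ eq) (injective (∷-injectiveʳ eq)) }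
      ; strictlySurjective = λ { (a ∷ v) → let (u , eq) = strictlySurjective v in a ∷ u , cong (a ∷_) eq }
      ; edge               = λ { (a ∷ u) (b ∷ v) → extend⇔ (_⊕_ 2 b (⊖_ 2 a)) (edge u v) }
      }
      where
      open V-Finite.CayleyIso iso
      extend⇔ : ∀ a {v w} → T (S v) ⇔ T (S′ w) → T (extend S (a ∷ v)) ⇔ T (extend S′ (a ∷ w))
      extend⇔ zero    e = e
      extend⇔ (suc _) e = mk⇔ id id

    scale : Fin 2 → Carrier → Carrier
    scale zero    x = ε
    scale (suc _) x = x

    scale-⊕ : ∀ a b x → scale (_⊕_ 2 a b) x ≡ scale a x ∙ scale b x
    scale-⊕ zero       zero       x = sym (identityˡ ε)
    scale-⊕ zero       (suc zero) x = sym (identityˡ x)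
    scale-⊕ (suc zero) zero       x = sym (identityʳ x)
    scale-⊕ (suc zero) (suc zero) x = sym (x∙x≡ε x)

    module _ {S S′} (t : E-Finite.Transport (extend S) (extend S′)) where
      open E-Finite.Transport t

      -- Call the first coordinate the height. If `(1, ε)` goes to height `0`, take a preimage of
      -- `(1, ε)`. Should that preimage have height `0`, adding `(1, ε)` raises it to height `1` and
      -- leaves the height of its image unchanged.
      height-one : ∃ λ v → ∃ λ x → fun (suc zero ∷ v) ≡ suc zero ∷ x
      height-one with fun (suc zero ∷ ε) in eq₁ | strictlySurjective (suc zero ∷ ε)
      ... | suc zero ∷ x | _                    = ε , x , eq₁
      ... | zero     ∷ x | suc zero ∷ v , eq₂   = v , ε , eq₂
      ... | zero     ∷ x | zero     ∷ v , eq₂   = v , x , (begin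
        fun (suc zero ∷ v)                      ≡⟨ cong (λ u → fun (suc zero ∷ u)) (identityˡ v) ⟨
        fun ((suc zero ∷ ε) E.∙ (zero ∷ v))     ≡⟨ homo (suc zero ∷ ε) (zero ∷ v) ⟩
        fun (suc zero ∷ ε) E.∙ fun (zero ∷ v)   ≡⟨ cong₂ E._∙_ eq₁ eq₂ ⟩
        suc zero ∷ x ∙ ε                        ≡⟨ cong (suc zero ∷_) (identityʳ x) ⟩
        suc zero ∷ x                            ∎)

      -- Writing fun (0, v) = (h v, A v), the endomorphism A is repaired to the injective
      -- γ = A + h x; injectivity holds because (1, x) is not in the image of 0 × V.
      restrict : V-Finite.Transport S S′
      restrict = record
        { fun       = γ
        ; homo      = γ-homo
        ; injective = γ-injective
        ; member    = λ v → mk⇔ (γ-preserves v) (γ-reflects v)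
        }
        where
        x : Carrier
        x = proj₁ (proj₂ height-one)

        fold : E.Carrier → Carrier
        fold (a ∷ v) = v ∙ scale a x

        fold-homo : ∀ y z → fold (y E.∙ z) ≡ fold y ∙ fold z
        fold-homo (a ∷ u) (b ∷ v) = trans
          (cong (u ∙ v ∙_) (scale-⊕ a b x))
          (interchange u v (scale a x) (scale b x))
          where open CommutativeSemigroupProperties commutativeSemigroup using (interchange)

        γ : Carrier → Carrier
        γ v = fold (fun (zero ∷ v))

        γ-homo : ∀ u v → γ (u ∙ v) ≡ γ u ∙ γ v
        γ-homo u v = trans (cong fold (homo (zero ∷ u) (zero ∷ v)))
          (fold-homo (fun (zero ∷ u)) (fun (zero ∷ v)))

        γ-kernel : ∀ v → γ v ≡ ε → v ≡ ε
        γ-kernel v γv≡ε with fun (zero ∷ v) in eq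
        ... | zero ∷ w = ∷-injectiveʳ (injective {zero ∷ v} {E.ε} (begin
          fun (zero ∷ v)  ≡⟨ eq ⟩
          zero ∷ w        ≡⟨ cong (zero ∷_) (trans (sym (identityʳ w)) γv≡ε) ⟩
          E.ε             ≡⟨ fun-ε ⟨
          fun E.ε         ∎))
        ... | suc zero ∷ w with () ← injective {zero ∷ v} {suc zero ∷ proj₁ height-one} (begin
          fun (zero ∷ v)                        ≡⟨ eq ⟩
          suc zero ∷ w                          ≡⟨ cong (suc zero ∷_) (inverseˡ-unique w x γv≡ε) ⟩
          suc zero ∷ x ⁻¹                       ≡⟨ cong (suc zero ∷_) (x⁻¹≡x x) ⟩
          suc zero ∷ x                          ≡⟨ proj₂ (proj₂ height-one) ⟨
          fun (suc zero ∷ proj₁ height-one)     ∎)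

        γ-injective : Injective _≡_ _≡_ γ
        γ-injective = V-Finite.homo∧trivialKernel⇒injective γ-homo γ-kernel

        -- Members of `extend S′` have first coordinate zero, where `fold` adds nothing; the repair
        -- of `A` therefore does not disturb the connection set.
        fold-member : ∀ y → T (extend S′ y) → T (S′ (fold y))
        fold-member (zero ∷ v) = subst (T ∘ S′) (sym (identityʳ v))

        γ-preserves : ∀ v → T (S v) → T (S′ (γ v))
        γ-preserves v v∈S = fold-member (fun (zero ∷ v)) (to (member (zero ∷ v)) v∈S)

        -- The preimage of `(0, γ v)` under `fun` lies in `extend S`, so it has the form `(0, u)`
        -- with `u` in `S`. Folding gives `γ u ≡ γ v`, hence `u ≡ v`.
        γ-reflects : ∀ v → T (S′ (γ v)) → T (S v)
        γ-reflects v γv∈S′ = let (y , eq) = strictlySurjective (zero ∷ γ v) in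
          reflect y eq (from (member y) (subst (T ∘ extend S′) (sym eq) γv∈S′))
          where
          reflect : ∀ y → fun y ≡ zero ∷ γ v → T (extend S y) → T (S v)
          reflect (zero ∷ u) eq = subst (T ∘ S)
            (γ-injective (trans (cong fold eq) (identityʳ (γ v))))

    DCI-suc⇒DCI : IsDCIGroup (ℤ/ 2 ^ᴳ (suc n)) → IsDCIGroup (ℤ/ 2 ^ᴳ n)
    DCI-suc⇒DCI dci S S′ Γ≅Γ′ = V-Finite.transport⇒automorphismEquivalent (restrict
      (E-Finite.automorphismEquivalent⇒transport (dci (extend S) (extend S′)
        (E-Finite.cayleyIso⇒≅ (extend-iso (V-Finite.≅⇒cayleyIso Γ≅Γ′))))))

  CI⇒DCI-2 : ∀ r → IsCIGroup (ℤ/ 2 ^ᴳ (2 + r)) → IsDCIGroup (ℤ/ 2 ^ᴳ r)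
  CI⇒DCI-2 r = DCI-suc⇒DCI r ∘ DCI-suc⇒DCI (suc r) ∘ CI⇒DCI (2 + r)

-- The case distinction on the prime.

theorem1p2 : (p r : ℕ) .{{_ : NonZero p}} → Prime p →
    ¬ IsDCIGroup (ℤ/ p ^ᴳ r) →
    (p ≢ 3) ⊎ (∃ λ (S : Subset (ℤ/ p ^ᴳ r)) → card (ℤ/ p ^ᴳ r) S < p ^ (r ∸ 1) × ¬ IsDCIDigraph (ℤ/ p ^ᴳ r) S) →
    ¬ IsCIGroup (ℤ/ p ^ᴳ (r + 2))
theorem1p2 p r p-prime ¬dci hyp ci =
  -- The exponent is turned into `2 + r` so that vectors expose the two coordinates of `W`.
  refute p p-prime ¬dci hyp (subst (λ n → IsCIGroup (ℤ/ p ^ᴳ n)) (ℕ.+-comm r 2) ci)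
  where
  refute : (p : ℕ) .{{_ : NonZero p}} → Prime p → ¬ IsDCIGroup (ℤ/ p ^ᴳ r) →
    (p ≢ 3) ⊎ (∃ λ (S : Subset (ℤ/ p ^ᴳ r)) → card (ℤ/ p ^ᴳ r) S < p ^ (r ∸ 1) × ¬ IsDCIDigraph (ℤ/ p ^ᴳ r) S) →
    ¬ IsCIGroup (ℤ/ p ^ᴳ (2 + r))
  refute 0 p-prime = contradiction p-prime ¬prime[0]
  refute 1 p-prime = contradiction p-prime ¬prime[1]
  refute 2 _ ¬dci _ ci = ¬dci (Two.CI⇒DCI-2 r ci)
  refute 3 _ _ (inj₁ 3≢3) _ = 3≢3 refl
  refute 3 _ _ (inj₂ (S , |S|< , ¬dci)) ci = ¬dci (Three.CI⇒smallDCI r ci S |S|<)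
  refute 4 p-prime = contradiction p-prime (composite⇒¬prime composite[4])
  refute (suc (suc (suc (suc (suc k))))) _ ¬dci _ ci = ¬dci (AtLeastFive.CI⇒DCI k r ci)
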